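{- Let $1\le m\le b$ and $n\ge1$. If $A=C_{S_1}\cdots C_{S_n}$ is a juggling card sequence whose $n$ cards are chosen independently and uniformly at random from the set of all cards $C_S$ with $S$ an ordered subset of $[b]$ of size $m$, then the probability that $\pi_A$ is a single cycle of length $b$ is exactly $1/b$ (independent of $n$).
   Context: There are $b$ balls on levels $1,\dots,b$. For an ordered subset $S=(s_1,\dots,s_m)$ of $[b]$ (distinct entries), the card $C_S$ induces the permutation $\pi_{C_S}$ of $[b]$ with $\pi_{C_S}(j)=s_j$ for $1\le j\le m$ and $\pi_{C_S}$ restricted to $\{m+1,\dots,b\}$ the order-preserving bijection onto $[b]\setminus\{s_1,\dots,s_m\}$. For $A=C_{S_1}\cdots C_{S_n}$, $\pi_A=\pi_{C_{S_n}}\circ\cdots\circ\pi_{C_{S_1}}$ (the ball starting at level $j$ ends at level $\pi_A(j)$). -}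

module Defs where

open import Data.Nat using (ℕ; zero; suc; _∸_; _<?_)
open import Data.Fin using (Fin; toℕ; fromℕ<)
open import Data.Fin.Properties using (any?; all?) renaming (_≟_ to _≟F_)
open import Data.List using (List; []; _∷_; map; concatMap; allFin; filter; length)
open import Data.Vec using (Vec; lookup; toList) renaming ([] to []ᵥ; _∷_ to _∷ᵥ_)
open import Data.Product using (∃)
open import Function using (id; _∘_)
open import Relation.Nullary using (Dec; yes; no; ¬?)
open import Relation.Binary.PropositionalEquality using (_≡_)
import Data.List.Relation.Unary.Unique.DecPropositional as UDec
import Data.List.Membership.DecPropositional as MemDec

-- A card C_S with S = (s_1,…,s_m) an ordered subset of [b] is represented by
-- the vector S : Vec (Fin b) m (levels 1..b are Fin b, i.e. 0..b-1),
-- whose entries are required to be distinct.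
Card : ℕ → ℕ → Set
Card b m = Vec (Fin b) m

allVecs : (b m : ℕ) → List (Vec (Fin b) m)
allVecs b zero    = []ᵥ ∷ []
allVecs b (suc m) = concatMap (λ x → map (x ∷ᵥ_) (allVecs b m)) (allFin b)

Distinct : ∀ {b m} → Vec (Fin b) m → Set
Distinct s = UDec.Unique _≟F_ (toList s)

distinct? : ∀ {b m} (s : Vec (Fin b) m) → Dec (Distinct s)
distinct? s = UDec.unique? _≟F_ (toList s)

allCards : (b m : ℕ) → List (Card b m)
allCards b m = filter distinct? (allVecs b m)

allSeqs : ∀ {A : Set} → List A → ℕ → List (List A)
allSeqs xs zero    = [] ∷ []
allSeqs xs (suc n) = concatMap (λ x → map (x ∷_) (allSeqs xs n)) xs

complement : ∀ {b m} → Vec (Fin b) m → List (Fin b)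
complement {b} s = filter (λ x → MemDec._∉?_ _≟F_ x (toList s)) (allFin b)

nth : ∀ {A : Set} → List A → ℕ → A → A
nth []       _       d = d
nth (x ∷ xs) zero    d = x
nth (x ∷ xs) (suc k) d = nth xs k d

-- The permutation π_{C_S}: (0-based) j < m ↦ s_j, and the levels j ≥ m are
-- mapped order-preservingly onto the complement of {s_1,…,s_m}.
-- (The default in nth is never used when S has distinct entries.)
πCard : ∀ {b m} → Card b m → Fin b → Fin b
πCard {b} {m} s j with toℕ j <? m
... | yes j<m = lookup s (fromℕ< j<m)
... | no  _   = nth (complement s) (toℕ j ∸ m) j

πSeq : ∀ {b m} → List (Card b m) → Fin b → Fin b
πSeq []       = id
πSeq (C ∷ Cs) = πSeq Cs ∘ πCard C

iterate : ∀ {A : Set} → (A → A) → ℕ → A → A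
iterate f zero    x = x
iterate f (suc k) x = f (iterate f k x)

IsFullCycle : ∀ {b} → (Fin b → Fin b) → Set
IsFullCycle {b} π = ∀ (x y : Fin b) → ∃ λ (k : Fin b) → iterate π (toℕ k) x ≡ y

isFullCycle? : ∀ {b} (π : Fin b → Fin b) → Dec (IsFullCycle π)
isFullCycle? π = all? λ x → all? λ y → any? λ k → iterate π (toℕ k) x ≟F y

sampleSpace : (b m n : ℕ) → List (List (Card b m))
sampleSpace b m n = allSeqs (allCards b m) n

favourable : (b m n : ℕ) → List (List (Card b m))
favourable b m n = filter (λ A → isFullCycle? (πSeq A)) (sampleSpace b m n)

{-# OPTIONS --safe #-}

-- Let B_k be the formal sum of the permutations of the cards throwing k balls.
-- They satisfy B₁ B_k = k B_k + B_{k+1}, so left multiplication by B₁, and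
-- inductively by every B_m, preserves the span of {B_k | k ≥ 1}; in particular
-- B_m^n lies in this span. It remains to treat a single card: contracting the
-- bottom level in its cycle structure identifies the full cycles in B_{k+1}
-- for b + 1 balls with those in B₁ B_k for b balls, and the identity above
-- turns this into a recursion for the number of full cycles in B_k.
module Submission where

open import Defs
open import Data.Bool using (if_then_else_; true; false)
open import Data.Fin as Fin using (Fin; zero; suc; toℕ; fromℕ<; lift; punchIn)
open import Data.Fin.Properties
  using (punchInᵢ≢i; punchIn-injective; toℕ<n; toℕ-fromℕ<; pigeonhole)
open import Data.List using (List; []; _∷_; _++_; map; concatMap; allFin; tabulate; filter; length)
open import Data.List.Membership.Propositional using (_∈_; _∉_)
import Data.List.Membership.DecPropositional as DecMembership
open import Data.List.Membership.Propositional.Properties using (∈-map⁻; ∈-map⁺)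
open import Data.List.Properties
  using (map-cong; map-∘; map-++; map-tabulate; length-map; length-tabulate;
         filter-accept; filter-reject; filter-≐; filter-all)
import Data.List.Relation.Unary.All as All
open import Data.List.Relation.Unary.All.Properties using (¬Any⇒All¬; All¬⇒¬Any)
import Data.List.Relation.Unary.AllPairs as AllPairs
open import Data.List.Relation.Unary.Any using (here; there)
open import Data.List.Relation.Unary.Unique.Propositional using (Unique)
import Data.List.Relation.Unary.Unique.Propositional.Properties as Unique
open import Data.Nat using (ℕ; zero; suc; _+_; _*_; _∸_; _≤_; _<_; _<?_; s<s; s<s⁻¹)
open import Data.Nat.Induction using (<-rec)
open import Data.Nat.ListAction using () renaming (sum to sumₗ)
open import Data.Nat.ListAction.Properties using (sum-++)
open import Data.Nat.Properties
  using (+-*-semiring; +-assoc; +-comm; +-identityʳ; +-suc; +-cancelˡ-≡; +-cancelʳ-<;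
         +-monoʳ-<; *-assoc; *-comm; *-identityˡ; *-zeroʳ; *-cancelˡ-≡; *-distribˡ-+;
         ≤-refl; ≤-trans; ≤-pred; ≮⇒≥; m∸n+n≡m)
open import Data.Product using (∃; _,_; proj₁; proj₂)
open import Data.Vec as Vec using (Vec; toList) renaming ([] to []ᵥ; _∷_ to _∷ᵥ_)
open import Data.Vec.Properties using (toList-map; lookup-map)
open import Function using (id; _∘_; _⇔_; mk⇔; Equivalence)
open import Level using (0ℓ)
open import Relation.Binary.PropositionalEquality
  using (_≡_; _≗_; refl; sym; trans; cong; cong₂; subst; subst₂; module ≡-Reasoning)
open import Relation.Nullary using (¬_; Dec; yes; no; does; contradiction)
open import Relation.Nullary.Decidable using (does-⇔; dec-true; dec-false)
open import Relation.Unary using (Pred; Decidable)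
open import Algebra.Properties.Semiring.Sum +-*-semiring
  using (sum; sum-cong-≗; sum-replicate-zero; sum-remove; ∑-distrib-+; ∑-comm; *-distribˡ-sum)

open ≡-Reasoning

private
  variable
    A B : Set
    b c k m n : ℕ

-- Sums of functionals over the permutations of cards.

Endo : ℕ → Set
Endo b = Fin b → Fin b

-- Maps that agree pointwise need not be propositionally equal, so functionals are required to
-- respect pointwise equality.
Extensional : (Endo b → ℕ) → Set
Extensional F = ∀ {f g} → f ≗ g → F f ≡ F g

-- The permutation of the card throwing a single ball, to level `s`: the summands of B₁.
insertBottom : Fin b → Endo b
insertBottom s zero    = s
insertBottom s (suc j) = punchIn s j

below : (Endo (suc b) → ℕ) → Fin (suc b) → Endo b → ℕ
below F s f = F (insertBottom s ∘ lift 1 f)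

-- Sum of F over the permutations π_{C_S}, |S| = k: deleting level 1 from the
-- domain and s_1 from the codomain turns C_S into a card of size k - 1 for
-- b - 1 balls.
Σcards : ∀ (b k : ℕ) → (Endo b → ℕ) → ℕ
Σcards b       zero    F = F id
Σcards zero    (suc k) F = 0
Σcards (suc b) (suc k) F = sum λ s → Σcards b k (below F s)

Σcards-cong : ∀ (b k : ℕ) {F G : Endo b → ℕ} → (∀ f → F f ≡ G f) → Σcards b k F ≡ Σcards b k G
Σcards-cong b       zero    eq = eq id
Σcards-cong zero    (suc k) eq = refl
Σcards-cong (suc b) (suc k) eq = sum-cong-≗ λ s → Σcards-cong b k λ f → eq (insertBottom s ∘ lift 1 f)

Σcards-sum : ∀ (b k : ℕ) (F : Fin n → Endo b → ℕ) →
  Σcards b k (λ f → sum λ i → F i f) ≡ sum λ i → Σcards b k (F i)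
Σcards-sum         b       zero    F = refl
Σcards-sum {n = n} zero    (suc k) F = sym (sum-replicate-zero n)
Σcards-sum         (suc b) (suc k) F =
  trans (sum-cong-≗ λ s → Σcards-sum b k λ i → below (F i) s)
        (∑-comm λ s i → Σcards b k (below (F i) s))

Σcards-+ : ∀ (b k : ℕ) (F G : Endo b → ℕ) →
  Σcards b k (λ f → F f + G f) ≡ Σcards b k F + Σcards b k G
Σcards-+ b       zero    F G = refl
Σcards-+ zero    (suc k) F G = refl
Σcards-+ (suc b) (suc k) F G =
  trans (sum-cong-≗ λ s → Σcards-+ b k (below F s) (below G s))
        (∑-distrib-+ (λ s → Σcards b k (below F s)) (λ s → Σcards b k (below G s)))

Σcards-* : ∀ (b k c : ℕ) (F : Endo b → ℕ) → Σcards b k (λ f → c * F f) ≡ c * Σcards b k F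
Σcards-* b       zero    c F = refl
Σcards-* zero    (suc k) c F = sym (*-zeroʳ c)
Σcards-* (suc b) (suc k) c F =
  trans (sum-cong-≗ λ s → Σcards-* b k c (below F s))
        (sym (*-distribˡ-sum c λ s → Σcards b k (below F s)))

Σcards-0 : ∀ (b k : ℕ) → Σcards b k (λ _ → 0) ≡ 0
Σcards-0 b k = Σcards-* b k 0 (λ _ → 0)

-- The product of B₁ and B_k.

lift-cong : {f g : Endo b} → f ≗ g → lift 1 f ≗ lift 1 g
lift-cong eq zero    = refl
lift-cong eq (suc j) = cong suc (eq j)

lift-id : lift 1 (id {A = Fin b}) ≗ id
lift-id zero    = refl
lift-id (suc j) = refl

lift-∘ : (f g : Endo b) → lift 1 f ∘ lift 1 g ≗ lift 1 (f ∘ g)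
lift-∘ f g zero    = refl
lift-∘ f g (suc j) = refl

insertBottom-zero : insertBottom {suc b} zero ≗ id
insertBottom-zero zero    = refl
insertBottom-zero (suc j) = refl

-- punchIn (punchIn s t) (pull s t) = s, so (s , t) ↦ (punchIn s t , pull s t)
-- swaps the two entries of an ordered pair of distinct levels.
pull : Fin (suc b) → Fin b → Fin b
pull {suc b} zero    t       = zero
pull {suc b} (suc s) zero    = s
pull {suc b} (suc s) (suc t) = suc (pull s t)

punchIn-pull : (s : Fin (suc b)) (t : Fin b) → punchIn (punchIn s t) (pull s t) ≡ s
punchIn-pull {suc b} zero    t       = refl
punchIn-pull {suc b} (suc s) zero    = refl
punchIn-pull {suc b} (suc s) (suc t) = cong suc (punchIn-pull s t)

-- Both sides are the order-preserving injection skipping `s` and `punchIn s t`, removed in either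
-- order.
punchIn-punchIn : (s : Fin (suc (suc b))) (t : Fin (suc b)) (j : Fin b) →
  punchIn s (punchIn t j) ≡ punchIn (punchIn s t) (punchIn (pull s t) j)
punchIn-punchIn zero    t       j       = refl
punchIn-punchIn (suc s) zero    j       = refl
punchIn-punchIn (suc s) (suc t) zero    = refl
punchIn-punchIn (suc s) (suc t) (suc j) = cong suc (punchIn-punchIn s t j)

-- Swapping the entries is an involution on ordered pairs of distinct levels, so it only reindexes
-- the sum. The induction splits off the pairs containing level zero, whose two kinds trade places.
sum-swap : (K : Fin (suc b) → Fin b → ℕ) →
  (sum λ s → sum λ t → K (punchIn s t) (pull s t)) ≡ (sum λ s → sum (K s))
sum-swap {zero}  K = refl
sum-swap {suc b} K = begin
  (sum λ t → K (suc t) zero) +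
    (sum λ s → K zero s + sum λ t → K (suc (punchIn s t)) (suc (pull s t)))
    ≡⟨ cong (sum (λ t → K (suc t) zero) +_)
         (∑-distrib-+ (K zero) (λ s → sum λ t → K (suc (punchIn s t)) (suc (pull s t)))) ⟩
  x + (y + sum λ s → sum λ t → K (suc (punchIn s t)) (suc (pull s t)))
    ≡⟨ cong (λ z → x + (y + z)) (sum-swap λ s t → K (suc s) (suc t)) ⟩
  x + (y + z)        ≡⟨ +-assoc x y z ⟨
  (x + y) + z        ≡⟨ cong (_+ z) (+-comm x y) ⟩
  (y + x) + z        ≡⟨ +-assoc y x z ⟩
  y + (x + z)        ≡⟨ cong (y +_) (∑-distrib-+ (λ s → K (suc s) zero) (λ s → sum λ t → K (suc s) (suc t))) ⟨
  y + (sum λ s → K (suc s) zero + sum λ t → K (suc s) (suc t)) ∎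
  where
  x = sum λ s → K (suc s) zero
  y = sum (K zero)
  z = sum λ s → sum λ t → K (suc s) (suc t)

-- After a throw to `suc t` the next ball drops to the bottom and is thrown to `s`, while the first
-- one ends at `punchIn s t`. Two single throws of different balls thus form one card throwing two
-- balls.
insertBottom-∘ : (s : Fin (suc b)) (t : Fin b) →
  insertBottom s ∘ insertBottom (suc t) ≗
  insertBottom (punchIn s t) ∘ lift 1 (insertBottom (pull s t))
insertBottom-∘         s t zero          = refl
insertBottom-∘ {suc b} s t (suc zero)    = sym (punchIn-pull s t)
insertBottom-∘ {suc b} s t (suc (suc j)) = punchIn-punchIn s t j

-- B₁ B_k = k B_k + B_{k+1}, by cases on whether the ball thrown by B₁ has
-- already been thrown.
Σcards-insertBottom : ∀ (b k : ℕ) {F : Endo b → ℕ} → Extensional F →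
  (sum λ s → Σcards b k λ f → F (insertBottom s ∘ f)) ≡ k * Σcards b k F + Σcards b (suc k) F
Σcards-insertBottom zero    zero    ext = refl
Σcards-insertBottom zero    (suc k) ext = sym (trans (+-identityʳ (k * 0)) (*-zeroʳ k))
Σcards-insertBottom (suc b) zero    ext =
  sum-cong-≗ λ s → ext λ j → cong (insertBottom s) (sym (lift-id j))
Σcards-insertBottom (suc b) (suc k) {F} ext = begin
  (sum λ s → sum λ t → L t s)
    ≡⟨ ∑-distrib-+ (L zero) (λ s → sum λ t → L (suc t) s) ⟩
  sum (L zero) + (sum λ s → sum λ t → L (suc t) s)
    -- For `t` = zero the first ball returns to the bottom and is thrown again, contributing one
    -- copy of B_{k+1}; the other k copies come from the induction.
    ≡⟨ cong₂ _+_
         (sum-cong-≗ λ s → Σcards-cong b k λ f → ext λ j →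
           cong (insertBottom s) (insertBottom-zero (lift 1 f j)))
         (sum-cong-≗ λ s → sum-cong-≗ λ t → Σcards-cong b k λ f → ext λ j →
           insertBottom-∘ s t (lift 1 f j)) ⟩
  X + (sum λ s → sum λ t → K (punchIn s t) (pull s t))
    -- After the swap `s` is the final level of the ball that started at the bottom. For fixed `s`
    -- the inner sum is a product B₁ B_k on the remaining levels, so induction applies.
    ≡⟨ cong (X +_) (sum-swap K) ⟩
  X + (sum λ s → sum (K s))
    ≡⟨ cong (X +_) (sum-cong-≗ λ s → trans
         (sum-cong-≗ λ t → Σcards-cong b k λ f → ext λ j →
           cong (insertBottom s) (lift-∘ (insertBottom t) f j))
         (Σcards-insertBottom b k λ eq → ext λ j → cong (insertBottom s) (lift-cong eq j))) ⟩
  X + (sum λ s → k * Y s + Z s)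
    ≡⟨ cong (X +_) (∑-distrib-+ (λ s → k * Y s) Z) ⟩
  X + ((sum λ s → k * Y s) + sum Z)
    ≡⟨ cong (λ w → X + (w + sum Z)) (*-distribˡ-sum k Y) ⟨
  X + (k * X + sum Z)
    ≡⟨ +-assoc X (k * X) (sum Z) ⟨
  X + k * X + sum Z ∎
  where
  L : Fin (suc b) → Fin (suc b) → ℕ
  L t s = Σcards b k λ f → F (insertBottom s ∘ insertBottom t ∘ lift 1 f)
  K : Fin (suc b) → Fin b → ℕ
  K s t = Σcards b k λ f → F (insertBottom s ∘ lift 1 (insertBottom t) ∘ lift 1 f)
  Y Z : Fin (suc b) → ℕ
  Y s = Σcards b k (below F s)
  Z s = Σcards b (suc k) (below F s)
  X = Σcards (suc b) (suc k) F

-- Functionals agreeing on the span of the B_k, and left multiplication by B_m.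

-- F and G have the same linear extension to the span of the B_k with k ≥ 1.
Balanced : (F G : Endo b → ℕ) → Set
Balanced {b} F G = ∀ k → Σcards b (suc k) F ≡ Σcards b (suc k) G

-- Left multiplication by B_m, transposed to act on functionals.
precompose : (m : ℕ) → (Endo b → ℕ) → Endo b → ℕ
precompose {b} m F τ = Σcards b m λ σ → F (σ ∘ τ)

insertAfter : (Endo b → ℕ) → Endo b → ℕ
insertAfter F τ = sum λ s → F (insertBottom s ∘ τ)

insertAfter-ext : {F : Endo b → ℕ} → Extensional F → Extensional (insertAfter F)
insertAfter-ext ext eq = sum-cong-≗ λ s → ext λ j → cong (insertBottom s) (eq j)

-- B₁ B_{k+1} is a combination of B_{k+1} and B_{k+2}, on both of which F and G agree.
insertAfter-balanced : {F G : Endo b → ℕ} → Extensional F → Extensional G →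
  Balanced F G → Balanced (insertAfter F) (insertAfter G)
insertAfter-balanced {b} {F} {G} extF extG bal k = begin
  Σcards b (suc k) (insertAfter F)
    ≡⟨ expand extF ⟩
  suc k * Σcards b (suc k) F + Σcards b (suc (suc k)) F
    ≡⟨ cong₂ (λ x y → suc k * x + y) (bal k) (bal (suc k)) ⟩
  suc k * Σcards b (suc k) G + Σcards b (suc (suc k)) G
    ≡⟨ expand extG ⟨
  Σcards b (suc k) (insertAfter G) ∎
  where
  expand : {H : Endo b → ℕ} → Extensional H → Σcards b (suc k) (insertAfter H) ≡
    suc k * Σcards b (suc k) H + Σcards b (suc (suc k)) H
  expand {H} ext = trans (Σcards-sum b (suc k) λ s f → H (insertBottom s ∘ f))
    (Σcards-insertBottom b (suc k) ext)

-- The relation B₁ B_m = m B_m + B_{m+1}, multiplied on the right by `τ`.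
precompose-insertAfter : ∀ m {F : Endo b → ℕ} → Extensional F → ∀ τ →
  precompose m (insertAfter F) τ ≡ m * precompose m F τ + precompose (suc m) F τ
precompose-insertAfter {b} m {F} ext τ =
  trans (Σcards-sum b m λ s σ → F (insertBottom s ∘ σ ∘ τ))
    (Σcards-insertBottom b m λ eq → ext (eq ∘ τ))

-- Induction on m through B_{m+1} = B₁ B_m - m B_m, with the subtraction expressed as a
-- cancellation. F and G vary in the induction, since the hypothesis for m is applied both to them
-- and to their images under `insertAfter`.
precompose-balanced : ∀ m {F G : Endo b → ℕ} → Extensional F → Extensional G →
  Balanced F G → Balanced (precompose m F) (precompose m G)
precompose-balanced zero    extF extG bal = bal
precompose-balanced {b} (suc m) {F} {G} extF extG bal k =
  +-cancelˡ-≡ (m * Σcards b (suc k) (precompose m F)) _ _ (begin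
    m * Σcards b (suc k) (precompose m F) + Σcards b (suc k) (precompose (suc m) F)
      ≡⟨ collect extF ⟨
    Σcards b (suc k) (precompose m (insertAfter F))
      ≡⟨ precompose-balanced m (insertAfter-ext extF) (insertAfter-ext extG)
           (insertAfter-balanced extF extG bal) k ⟩
    Σcards b (suc k) (precompose m (insertAfter G))
      ≡⟨ collect extG ⟩
    m * Σcards b (suc k) (precompose m G) + Σcards b (suc k) (precompose (suc m) G)
      ≡⟨ cong (λ x → m * x + Σcards b (suc k) (precompose (suc m) G))
           (precompose-balanced m extF extG bal k) ⟨
    m * Σcards b (suc k) (precompose m F) + Σcards b (suc k) (precompose (suc m) G) ∎)
  where
  collect : {H : Endo b → ℕ} → Extensional H →
    Σcards b (suc k) (precompose m (insertAfter H)) ≡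
    m * Σcards b (suc k) (precompose m H) + Σcards b (suc k) (precompose (suc m) H)
  collect {H} ext = begin
    Σcards b (suc k) (precompose m (insertAfter H))
      ≡⟨ Σcards-cong b (suc k) (precompose-insertAfter m ext) ⟩
    Σcards b (suc k) (λ τ → m * precompose m H τ + precompose (suc m) H τ)
      ≡⟨ Σcards-+ b (suc k) _ _ ⟩
    Σcards b (suc k) (λ τ → m * precompose m H τ) + Σcards b (suc k) (precompose (suc m) H)
      ≡⟨ cong (_+ Σcards b (suc k) (precompose (suc m) H)) (Σcards-* b (suc k) m (precompose m H)) ⟩
    m * Σcards b (suc k) (precompose m H) + Σcards b (suc k) (precompose (suc m) H) ∎

-- Iterates, reachability and full cycles.

iterate-cong : {f g : A → A} → f ≗ g → ∀ k → iterate f k ≗ iterate g k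
iterate-cong         eq zero    x = refl
iterate-cong {g = g} eq (suc k) x = trans (eq _) (cong g (iterate-cong eq k x))

iterate-+ : (f : A → A) → ∀ j k x → iterate f (j + k) x ≡ iterate f j (iterate f k x)
iterate-+ f zero    k x = refl
iterate-+ f (suc j) k x = cong f (iterate-+ f j k x)

-- With an unbounded exponent reachability composes freely; `iterate-bounded` restores the bound
-- that `IsFullCycle` demands.
Reach : (A → A) → A → A → Set
Reach f x y = ∃ λ k → iterate f k x ≡ y

reach-trans : {f : A → A} {x y z : A} → Reach f x y → Reach f y z → Reach f x z
reach-trans {f = f} {x} (k , refl) (j , refl) = j + k , iterate-+ f j k x

-- Two of the iterates with exponents 0 to b coincide, so an exponent k >= b can be shortened by
-- their gap, and strong induction finishes.
iterate-bounded : (f : Endo b) (x : Fin b) → ∀ k →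
  ∃ λ (i : Fin b) → iterate f (toℕ i) x ≡ iterate f k x
iterate-bounded {b} f x = <-rec _ bounded
  where
  bounded : ∀ k → (∀ {j} → j < k → ∃ λ (i : Fin b) → iterate f (toℕ i) x ≡ iterate f j x) →
    ∃ λ (i : Fin b) → iterate f (toℕ i) x ≡ iterate f k x
  bounded k rec with k <? b
  ... | yes k<b = fromℕ< k<b , cong (λ i → iterate f i x) (toℕ-fromℕ< k<b)
  ... | no  k≮b = proj₁ earlier , trans (proj₂ earlier) skip
    where
    repetition = pigeonhole {m = b} ≤-refl (λ i → iterate f (toℕ i) x)
    i j : ℕ
    i = toℕ (proj₁ repetition)
    j = toℕ (proj₁ (proj₂ repetition))
    i<j : i < j
    i<j = proj₁ (proj₂ (proj₂ repetition))
    k∸j+j≡k : (k ∸ j) + j ≡ k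
    k∸j+j≡k = m∸n+n≡m (≤-trans (≤-pred (toℕ<n (proj₁ (proj₂ repetition)))) (≮⇒≥ k≮b))
    earlier = rec (subst ((k ∸ j) + i <_) k∸j+j≡k (+-monoʳ-< (k ∸ j) i<j))
    skip : iterate f ((k ∸ j) + i) x ≡ iterate f k x
    skip = begin
      iterate f ((k ∸ j) + i) x          ≡⟨ iterate-+ f (k ∸ j) i x ⟩
      iterate f (k ∸ j) (iterate f i x)
        ≡⟨ cong (iterate f (k ∸ j)) (proj₂ (proj₂ (proj₂ repetition))) ⟩
      iterate f (k ∸ j) (iterate f j x)  ≡⟨ iterate-+ f (k ∸ j) j x ⟨
      iterate f ((k ∸ j) + j) x          ≡⟨ cong (λ l → iterate f l x) k∸j+j≡k ⟩
      iterate f k x                      ∎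

reach⇒fullCycle : {f : Endo b} → (∀ x y → Reach f x y) → IsFullCycle f
reach⇒fullCycle {f = f} reach x y =
  let k , eq = reach x y
      i , eq′ = iterate-bounded f x k
  in i , trans eq′ eq

fullCycle⇒reach : {f : Endo b} → IsFullCycle f → ∀ x y → Reach f x y
fullCycle⇒reach full x y = toℕ (proj₁ (full x y)) , proj₂ (full x y)

fullCycle-cong : {f g : Endo b} → f ≗ g → IsFullCycle f → IsFullCycle g
fullCycle-cong eq full x y =
  proj₁ (full x y) , trans (sym (iterate-cong eq (toℕ (proj₁ (full x y))) x)) (proj₂ (full x y))

-- Contraction of the bottom level in the cycle structure.

-- The cycles of g are those of h, shifted up by one level, with zero inserted
-- in front of suc s.
module _ (s : Fin (suc c)) (f : Endo (suc c)) where
  private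
    g : Endo (suc (suc c))
    g = insertBottom (suc s) ∘ lift 1 f

    h : Endo (suc c)
    h = insertBottom s ∘ f

    collapse : Fin (suc (suc c)) → Fin (suc c)
    collapse zero    = s
    collapse (suc j) = j

    -- The step of `g` from zero to `suc s` is contracted away. Every other step is one step of `h`;
    -- if it leads to zero, `h` goes to `s`, onto which zero is contracted.
    collapse-step : ∀ x → Reach h (collapse x) (collapse (g x))
    collapse-step zero = 0 , refl
    collapse-step (suc j) = 1 , h≡collapse
      where
      h≡collapse : h j ≡ collapse (punchIn (suc s) (f j))
      h≡collapse with f j
      ... | zero  = refl
      ... | suc i = refl

    collapse-iterate : ∀ k x → Reach h (collapse x) (collapse (iterate g k x))
    collapse-iterate zero    x = 0 , refl
    collapse-iterate (suc k) x = reach-trans (collapse-iterate k x) (collapse-step (iterate g k x))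

    g-zero : ∀ {j} → f j ≡ zero → g (suc j) ≡ zero
    g-zero eq = cong (insertBottom (suc s) ∘ suc) eq

    g-suc : ∀ {j i} → f j ≡ suc i → g (suc j) ≡ suc (punchIn s i)
    g-suc eq = cong (insertBottom (suc s) ∘ suc) eq

    expand-step : ∀ j → Reach g (suc j) (suc (h j))
    expand-step j with f j in eq
    -- Here `h j` is `s`, and `g` runs from `suc j` through zero to `suc s`.
    ... | zero  = 2 , cong g (g-zero eq)
    ... | suc i = 1 , g-suc eq

    expand-iterate : ∀ k j → Reach g (suc j) (suc (iterate h k j))
    expand-iterate zero    j = 0 , refl
    expand-iterate (suc k) j = reach-trans (expand-iterate k j) (expand-step (iterate h k j))

    module _ (full : IsFullCycle h) where

      -- A full cycle sends some level to `s`, and `insertBottom s` takes the value `s` only at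
      -- zero.
      zero-attained : ∃ λ j → f j ≡ zero
      -- Starting from `h s` instead of `s` ensures that `h` is applied at least once.
      zero-attained with fullCycle⇒reach full (h s) s
      ... | k , eq with f (iterate h k s) in feq
      ...   | zero  = iterate h k s , feq
      ...   | suc i = contradiction
        (begin
          punchIn s i                    ≡⟨ cong (insertBottom s) feq ⟨
          h (iterate h k s)              ≡⟨⟩
          iterate h (1 + k) s            ≡⟨ cong (λ n → iterate h n s) (+-comm 1 k) ⟩
          iterate h (k + 1) s            ≡⟨ iterate-+ h k 1 s ⟩
          iterate h k (h s)              ≡⟨ eq ⟩
          s                              ∎)
        (punchInᵢ≢i s i)

      reach-suc-suc : ∀ x y → Reach g (suc x) (suc y)
      reach-suc-suc x y with fullCycle⇒reach full x y
      ... | k , refl = expand-iterate k x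

      reach-suc : ∀ x y → Reach g x (suc y)
      reach-suc zero    y = reach-trans (1 , refl) (reach-suc-suc s y)
      reach-suc (suc x) y = reach-suc-suc x y

      reach-all : ∀ x y → Reach g x y
      reach-all x (suc y) = reach-suc x y
      reach-all x zero =
        let j , fj≡0 = zero-attained in reach-trans (reach-suc x j) (1 , g-zero fj≡0)

  fullCycle-insertBottom-suc :
    IsFullCycle (insertBottom (suc s) ∘ lift 1 f) ⇔ IsFullCycle (insertBottom s ∘ f)
  fullCycle-insertBottom-suc = mk⇔
    (λ full → reach⇒fullCycle λ x y → contract x y (fullCycle⇒reach full (suc x) (suc y)))
    (λ full → reach⇒fullCycle (reach-all full))
    where
    contract : ∀ x y → Reach g (suc x) (suc y) → Reach h x y
    contract x y (k , eq) =
      subst (Reach h x) (cong collapse eq) (collapse-iterate k (suc x))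

-- The bottom level is a fixed point among at least two levels.
¬fullCycle-insertBottom-zero : (f : Endo (suc c)) → ¬ IsFullCycle (insertBottom zero ∘ lift 1 f)
¬fullCycle-insertBottom-zero f full with fullCycle⇒reach full zero (suc zero)
... | k , eq with trans (sym (fixed k)) eq
  where
  fixed : ∀ k → iterate (insertBottom zero ∘ lift 1 f) k zero ≡ zero
  fixed zero    = refl
  fixed (suc k) = cong (insertBottom zero ∘ lift 1 f) (fixed k)
... | ()

-- Counting the full cycles of a single card.

cycleIndicator : Endo b → ℕ
cycleIndicator f = if does (isFullCycle? f) then 1 else 0

cycleIndicator-⇔ : {f : Endo b} {g : Endo c} → IsFullCycle f ⇔ IsFullCycle g →
  cycleIndicator f ≡ cycleIndicator g
cycleIndicator-⇔ {f = f} {g} equiv =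
  cong (if_then 1 else 0) (does-⇔ equiv (isFullCycle? f) (isFullCycle? g))

cycleIndicator-ext : Extensional {b} cycleIndicator
cycleIndicator-ext eq = cycleIndicator-⇔ (mk⇔ (fullCycle-cong eq) (fullCycle-cong (sym ∘ eq)))

sum-const : ∀ n x → (sum λ (_ : Fin n) → x) ≡ n * x
sum-const zero    x = refl
sum-const (suc n) x = cong (x +_) (sum-const n x)

-- Split by the first throw: to the bottom it yields no full cycle, and to `suc s` it contracts to a
-- summand of B₁ B_k with one ball fewer.
Σcards-cycleIndicator : ∀ c k → Σcards (suc (suc c)) (suc k) cycleIndicator ≡
  k * Σcards (suc c) k cycleIndicator + Σcards (suc c) (suc k) cycleIndicator
Σcards-cycleIndicator c k = begin
  Σcards (suc c) k (λ f → cycleIndicator (insertBottom zero ∘ lift 1 f)) +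
    (sum λ s → Σcards (suc c) k λ f → cycleIndicator (insertBottom (suc s) ∘ lift 1 f))
    ≡⟨ cong₂ _+_
         (trans (Σcards-cong (suc c) k λ f → cong (if_then 1 else 0)
                  (dec-false (isFullCycle? _) (¬fullCycle-insertBottom-zero f)))
                (Σcards-0 (suc c) k))
         (sum-cong-≗ λ s → Σcards-cong (suc c) k λ f →
           cycleIndicator-⇔ (fullCycle-insertBottom-suc s f)) ⟩
  (sum λ s → Σcards (suc c) k λ f → cycleIndicator (insertBottom s ∘ f))
    ≡⟨ Σcards-insertBottom (suc c) k cycleIndicator-ext ⟩
  k * Σcards (suc c) k cycleIndicator + Σcards (suc c) (suc k) cycleIndicator ∎

-- Cycle counts and total counts for `d` balls are governed by the same relation for B₁ B_k. Hence
-- the number `N` of full cycles equals `T k`, while the total for `suc d` balls is `suc d` times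
-- `T k`.
cycleIndicator-balanced-suc : ∀ {c} →
  Balanced {suc c} (λ f → suc c * cycleIndicator f) (λ _ → 1) →
  Balanced {suc (suc c)} (λ f → suc (suc c) * cycleIndicator f) (λ _ → 1)
cycleIndicator-balanced-suc {c} bal k = begin
  Σcards (suc d) (suc k) (λ f → suc d * cycleIndicator f)
    ≡⟨ Σcards-* (suc d) (suc k) (suc d) cycleIndicator ⟩
  suc d * N
    ≡⟨ cong (suc d *_) (*-cancelˡ-≡ N (T k) d dN≡dT) ⟩
  suc d * T k
    ≡⟨ sum-const (suc d) (T k) ⟨
  Σcards (suc d) (suc k) (λ _ → 1) ∎
  where
  d = suc c
  N = Σcards (suc d) (suc k) cycleIndicator
  T C : ℕ → ℕ
  T k = Σcards d k λ _ → 1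
  C k = Σcards d k cycleIndicator

  dC≡T : ∀ k → d * C (suc k) ≡ T (suc k)
  dC≡T k = trans (sym (Σcards-* d (suc k) d cycleIndicator)) (bal k)

  kdC≡kT : ∀ k → k * (d * C k) ≡ k * T k
  -- The hypothesis concerns only k >= 1; at k = 0 the factor k makes both sides vanish.
  kdC≡kT zero    = refl
  kdC≡kT (suc k) = cong (suc k *_) (dC≡T k)

  dN≡dT : d * N ≡ d * T k
  dN≡dT = begin
    d * N                             ≡⟨ cong (d *_) (Σcards-cycleIndicator c k) ⟩
    d * (k * C k + C (suc k))         ≡⟨ *-distribˡ-+ d (k * C k) (C (suc k)) ⟩
    d * (k * C k) + d * C (suc k)     ≡⟨ cong (_+ d * C (suc k)) (*-assoc d k (C k)) ⟨
    d * k * C k + d * C (suc k)       ≡⟨ cong (λ x → x * C k + d * C (suc k)) (*-comm d k) ⟩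
    k * d * C k + d * C (suc k)       ≡⟨ cong (_+ d * C (suc k)) (*-assoc k d (C k)) ⟩
    k * (d * C k) + d * C (suc k)     ≡⟨ cong₂ _+_ (kdC≡kT k) (dC≡T k) ⟩
    k * T k + T (suc k)               ≡⟨ Σcards-insertBottom d k (λ _ → refl) ⟨
    (sum λ (_ : Fin d) → T k)         ≡⟨ sum-const d (T k) ⟩
    d * T k                           ∎

-- The single-card case of the theorem, phrased as agreement of functionals so that it can be
-- carried along left multiplication by B_m.
cycleIndicator-balanced : ∀ b → Balanced {b} (λ f → b * cycleIndicator f) (λ _ → 1)
cycleIndicator-balanced zero k = refl
cycleIndicator-balanced (suc zero) k = Σcards-cong 1 (suc k) λ f →
  trans (*-identityˡ (cycleIndicator f))
    (cong (if_then 1 else 0) (dec-true (isFullCycle? f) λ { zero zero → zero , refl }))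
cycleIndicator-balanced (suc (suc c)) = cycleIndicator-balanced-suc (cycleIndicator-balanced (suc c))

-- Cards as vectors with distinct entries, and removal of the first throw.

filter-map : {P : Pred B 0ℓ} (P? : Decidable P) (f : A → B) (xs : List A) →
  filter P? (map f xs) ≡ map f (filter (P? ∘ f) xs)
filter-map P? f [] = refl
filter-map P? f (x ∷ xs) with does (P? (f x))
... | true  = cong (f x ∷_) (filter-map P? f xs)
... | false = filter-map P? f xs

filter-tabulate-suc : {P : Pred (Fin (suc b)) 0ℓ} (P? : Decidable P) →
  filter P? (tabulate suc) ≡ map suc (filter (P? ∘ suc) (allFin b))
filter-tabulate-suc P? = trans (cong (filter P?) (sym (map-tabulate id suc))) (filter-map P? suc (allFin _))

-- `punchIn x` lists all levels but `x` in increasing order, so a filter rejecting `x` can be moved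
-- past it.
filter-punchIn : {P : Pred (Fin (suc b)) 0ℓ} {Q : Pred (Fin b) 0ℓ}
  (P? : Decidable P) (Q? : Decidable Q) (x : Fin (suc b)) →
  ¬ P x → (∀ j → P (punchIn x j) ⇔ Q j) →
  filter P? (allFin (suc b)) ≡ map (punchIn x) (filter Q? (allFin b))
filter-punchIn {b} P? Q? zero ¬Px P⇔Q = begin
  filter P? (allFin (suc b))                   ≡⟨ filter-reject P? ¬Px ⟩
  filter P? (tabulate suc)                     ≡⟨ filter-tabulate-suc P? ⟩
  map suc (filter (P? ∘ suc) (allFin b))
    ≡⟨ cong (map suc) (filter-≐ (P? ∘ suc) Q?
         ((λ {j} → Equivalence.to (P⇔Q j)) , (λ {j} → Equivalence.from (P⇔Q j))) (allFin b)) ⟩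
  map suc (filter Q? (allFin b))               ∎
filter-punchIn {suc b} {Q = Q} P? Q? (suc x) ¬Px P⇔Q = go (Q? zero)
  where
  rest : filter P? (tabulate suc) ≡ map (punchIn (suc x)) (filter Q? (tabulate suc))
  rest = begin
    filter P? (tabulate suc)
      ≡⟨ filter-tabulate-suc P? ⟩
    map suc (filter (P? ∘ suc) (allFin (suc b)))
      ≡⟨ cong (map suc) (filter-punchIn (P? ∘ suc) (Q? ∘ suc) x ¬Px (P⇔Q ∘ suc)) ⟩
    map suc (map (punchIn x) (filter (Q? ∘ suc) (allFin b)))
      ≡⟨ map-∘ (filter (Q? ∘ suc) (allFin b)) ⟨
    map (suc ∘ punchIn x) (filter (Q? ∘ suc) (allFin b))
      ≡⟨ map-∘ (filter (Q? ∘ suc) (allFin b)) ⟩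
    map (punchIn (suc x)) (map suc (filter (Q? ∘ suc) (allFin b)))
      ≡⟨ cong (map (punchIn (suc x))) (filter-tabulate-suc Q?) ⟨
    map (punchIn (suc x)) (filter Q? (tabulate suc)) ∎
  go : Dec (Q zero) → filter P? (allFin (suc (suc b))) ≡ map (punchIn (suc x)) (filter Q? (allFin (suc b)))
  go (yes q) = begin
    filter P? (allFin (suc (suc b)))  ≡⟨ filter-accept P? (Equivalence.from (P⇔Q zero) q) ⟩
    zero ∷ filter P? (tabulate suc)   ≡⟨ cong (zero ∷_) rest ⟩
    map (punchIn (suc x)) (zero ∷ filter Q? (tabulate suc))
      ≡⟨ cong (map (punchIn (suc x))) (filter-accept Q? q) ⟨
    map (punchIn (suc x)) (filter Q? (allFin (suc b))) ∎
  go (no ¬q) = begin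
    filter P? (allFin (suc (suc b)))  ≡⟨ filter-reject P? (¬q ∘ Equivalence.to (P⇔Q zero)) ⟩
    filter P? (tabulate suc)          ≡⟨ rest ⟩
    map (punchIn (suc x)) (filter Q? (tabulate suc))
      ≡⟨ cong (map (punchIn (suc x))) (filter-reject Q? ¬q) ⟨
    map (punchIn (suc x)) (filter Q? (allFin (suc b))) ∎

prepend : Fin (suc b) → Vec (Fin b) m → Vec (Fin (suc b)) (suc m)
prepend x S = x ∷ᵥ Vec.map (punchIn x) S

∉-map-punchIn : (x : Fin (suc b)) (S : Vec (Fin b) m) → x ∉ toList (Vec.map (punchIn x) S)
∉-map-punchIn x S x∈ with ∈-map⁻ (punchIn x) (subst (x ∈_) (toList-map (punchIn x) S) x∈)
... | y , _ , eq = punchInᵢ≢i x y (sym eq)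

∈-prepend : (x : Fin (suc b)) (S : Vec (Fin b) m) (j : Fin b) →
  punchIn x j ∈ toList (prepend x S) ⇔ j ∈ toList S
∈-prepend x S j = mk⇔ to from
  where
  to : punchIn x j ∈ toList (prepend x S) → j ∈ toList S
  to (here eq) = contradiction eq (punchInᵢ≢i x j)
  to (there j∈) with ∈-map⁻ (punchIn x) (subst (punchIn x j ∈_) (toList-map (punchIn x) S) j∈)
  ... | i , i∈ , eq = subst (_∈ toList S) (sym (punchIn-injective x j i eq)) i∈
  from : j ∈ toList S → punchIn x j ∈ toList (prepend x S)
  from j∈ = there (subst (punchIn x j ∈_) (sym (toList-map (punchIn x) S)) (∈-map⁺ (punchIn x) j∈))

complement-prepend : (x : Fin (suc b)) (S : Vec (Fin b) m) →
  complement (prepend x S) ≡ map (punchIn x) (complement S)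
complement-prepend x S = filter-punchIn
  (λ y → DecMembership._∉?_ Fin._≟_ y (toList (prepend x S)))
  (λ y → DecMembership._∉?_ Fin._≟_ y (toList S)) x (λ x∉ → x∉ (here refl)) λ j → mk⇔
  (λ j∉ j∈ → j∉ (Equivalence.from (∈-prepend x S j) j∈))
  (λ j∉ j∈ → j∉ (Equivalence.to (∈-prepend x S j) j∈))

distinct-prepend : (x : Fin (suc b)) (S : Vec (Fin b) m) → Distinct (prepend x S) ⇔ Distinct S
distinct-prepend x S = mk⇔
  (λ { (_ AllPairs.∷ d) → Unique.map⁻ (subst Unique (toList-map (punchIn x) S) d) })
  (λ d → ¬Any⇒All¬ _ (∉-map-punchIn x S) AllPairs.∷
    subst Unique (sym (toList-map (punchIn x) S)) (Unique.map⁺ (punchIn-injective x _ _) d))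

-- The vectors with distinct entries, built by the recursion of Σcards.
data Reduced : Vec (Fin b) m → Set where
  []  : Reduced {b} []ᵥ
  _∷_ : (x : Fin (suc b)) {S : Vec (Fin b) m} → Reduced S → Reduced (prepend x S)

-- This keeps `nth` in `πCard` within bounds, so that its default value is never returned.
length-complement : {S : Vec (Fin b) m} → Reduced S → length (complement S) + m ≡ b
length-complement {b} [] = trans (+-identityʳ _) (trans
  (cong length (filter-all _ (All.universal (λ _ ()) (allFin b)))) (length-tabulate id))
length-complement {suc b} {suc m} (_∷_ x {S} r) = begin
  length (complement (prepend x S)) + suc m
    ≡⟨ cong (λ xs → length xs + suc m) (complement-prepend x S) ⟩
  length (map (punchIn x) (complement S)) + suc m
    ≡⟨ cong (_+ suc m) (length-map (punchIn x) (complement S)) ⟩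
  length (complement S) + suc m      ≡⟨ +-suc (length (complement S)) m ⟩
  suc (length (complement S) + m)    ≡⟨ cong suc (length-complement r) ⟩
  suc b                              ∎

nth-map : (f : A → B) (xs : List A) → ∀ {k d d′} → k < length xs →
  nth (map f xs) k d ≡ f (nth xs k d′)
nth-map f (x ∷ xs) {zero}  _   = refl
nth-map f (x ∷ xs) {suc k} k<n = nth-map f xs (s<s⁻¹ k<n)

-- The link to the recursion of `Σcards`: the later throws and the complement of `prepend x S` are
-- those of `S` relabelled by `punchIn x`.
πCard-prepend : (x : Fin (suc b)) {S : Vec (Fin b) m} → Reduced S →
  πCard (prepend x S) ≗ insertBottom x ∘ lift 1 (πCard S)
πCard-prepend x r zero = refl
πCard-prepend {b} {m} x {S} r (suc j) with toℕ j <? m | suc (toℕ j) <? suc m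
... | yes j<m | yes _    = lookup-map (fromℕ< j<m) (punchIn x) S
... | yes j<m | no  ¬j<m = contradiction (s<s j<m) ¬j<m
... | no  ¬j<m | yes j<m = contradiction (s<s⁻¹ j<m) ¬j<m
... | no  j≮m | no  _    = begin
  nth (complement (prepend x S)) (toℕ j ∸ m) (suc j)
    ≡⟨ cong (λ xs → nth xs (toℕ j ∸ m) (suc j)) (complement-prepend x S) ⟩
  nth (map (punchIn x) (complement S)) (toℕ j ∸ m) (suc j)
    ≡⟨ nth-map (punchIn x) (complement S) bound ⟩
  punchIn x (nth (complement S) (toℕ j ∸ m) j) ∎
  where
  bound : toℕ j ∸ m < length (complement S)
  bound = +-cancelʳ-< m _ _ (subst₂ _<_ (sym (m∸n+n≡m (≮⇒≥ j≮m))) (sym (length-complement r)) (toℕ<n j))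

πCard-[] : πCard {b} []ᵥ ≗ id
πCard-[] {b} j = trans
  (cong (λ xs → nth xs (toℕ j) j) (filter-all _ (All.universal (λ _ ()) (allFin b))))
  (nth-tabulate id j)
  where
  nth-tabulate : (f : Fin n → A) → ∀ {d} j → nth (tabulate f) (toℕ j) d ≡ f j
  nth-tabulate f zero    = refl
  nth-tabulate f (suc j) = nth-tabulate (f ∘ suc) j

-- From list sums over cards to the recursive sum.

Σvecs : ∀ b m → (Vec (Fin b) m → ℕ) → ℕ
Σvecs b zero    G = G []ᵥ
Σvecs b (suc m) G = sum λ x → Σvecs b m λ S → G (x ∷ᵥ S)

Σvecs-cong : ∀ b m {G H : Vec (Fin b) m → ℕ} → (∀ S → G S ≡ H S) → Σvecs b m G ≡ Σvecs b m H
Σvecs-cong b zero    eq = eq []ᵥ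
Σvecs-cong b (suc m) eq = sum-cong-≗ λ x → Σvecs-cong b m λ S → eq (x ∷ᵥ S)

Σvecs-0 : ∀ b m → Σvecs b m (λ _ → 0) ≡ 0
Σvecs-0 b zero    = refl
Σvecs-0 b (suc m) = trans (sum-cong-≗ λ (x : Fin b) → Σvecs-0 b m) (sum-replicate-zero b)

-- Vectors containing `x` contribute zero, and all others are images under `punchIn x`.
Σvecs-avoiding : ∀ m (x : Fin (suc b)) {G : Vec (Fin (suc b)) m → ℕ} →
  (∀ S → x ∈ toList S → G S ≡ 0) →
  Σvecs (suc b) m G ≡ Σvecs b m (G ∘ Vec.map (punchIn x))
Σvecs-avoiding     zero    x avoid = refl
Σvecs-avoiding {b} (suc m) x {G} avoid = begin
  sum (λ y → Σvecs (suc b) m λ S → G (y ∷ᵥ S))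
    ≡⟨ sum-remove {i = x} (λ y → Σvecs (suc b) m λ S → G (y ∷ᵥ S)) ⟩
  Σvecs (suc b) m (λ S → G (x ∷ᵥ S)) + sum (λ y → Σvecs (suc b) m λ S → G (punchIn x y ∷ᵥ S))
    ≡⟨ cong₂ _+_
         (trans (Σvecs-cong (suc b) m λ S → avoid (x ∷ᵥ S) (here refl)) (Σvecs-0 (suc b) m))
         (sum-cong-≗ λ y → Σvecs-avoiding m x λ S x∈ → avoid (punchIn x y ∷ᵥ S) (there x∈)) ⟩
  sum (λ y → Σvecs b m λ S → G (punchIn x y ∷ᵥ Vec.map (punchIn x) S)) ∎

-- Distinctness forces the entries after `x` to avoid `x`, so each inner sum descends to one level
-- fewer. `H` is kept apart from `F ∘ πCard` because, after throws are removed, the two are known to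
-- agree only on reduced vectors.
Σdistinct : ∀ b m (F : Endo b → ℕ) → Extensional F → (H : Vec (Fin b) m → ℕ) →
  (∀ S → Reduced S → H S ≡ F (πCard S)) →
  Σvecs b m (λ S → if does (distinct? S) then H S else 0) ≡ Σcards b m F
Σdistinct b       zero    F ext H eq = trans (eq []ᵥ []) (ext πCard-[])
Σdistinct zero    (suc m) F ext H eq = refl
Σdistinct (suc b) (suc m) F ext H eq = sum-cong-≗ λ x → begin
  Σvecs (suc b) m (λ S → if does (distinct? (x ∷ᵥ S)) then H (x ∷ᵥ S) else 0)
    ≡⟨ Σvecs-avoiding m x (λ S x∈ → cong (if_then H (x ∷ᵥ S) else 0)
         (dec-false (distinct? (x ∷ᵥ S)) λ { (x∉ AllPairs.∷ _) → All¬⇒¬Any x∉ x∈ })) ⟩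
  Σvecs b m (λ S → if does (distinct? (prepend x S)) then H (prepend x S) else 0)
    ≡⟨ Σvecs-cong b m (λ S → cong (if_then H (prepend x S) else 0)
         (does-⇔ (distinct-prepend x S) (distinct? (prepend x S)) (distinct? S))) ⟩
  Σvecs b m (λ S → if does (distinct? S) then H (prepend x S) else 0)
    ≡⟨ Σdistinct b m (below F x) (λ fg → ext λ j → cong (insertBottom x) (lift-cong fg j))
         (H ∘ prepend x) (λ S r → trans (eq (prepend x S) (x ∷ r)) (ext (πCard-prepend x r))) ⟩
  Σcards b m (below F x) ∎

sum-filter : {P : Pred A 0ℓ} (P? : Decidable P) (G : A → ℕ) (xs : List A) →
  sumₗ (map G (filter P? xs)) ≡ sumₗ (map (λ x → if does (P? x) then G x else 0) xs)
sum-filter P? G [] = refl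
sum-filter P? G (x ∷ xs) with does (P? x)
... | true  = cong (G x +_) (sum-filter P? G xs)
... | false = sum-filter P? G xs

sum-concatMap : (G : B → ℕ) (h : A → List B) (xs : List A) →
  sumₗ (map G (concatMap h xs)) ≡ sumₗ (map (λ x → sumₗ (map G (h x))) xs)
sum-concatMap G h [] = refl
sum-concatMap G h (x ∷ xs) = begin
  sumₗ (map G (h x ++ concatMap h xs))
    ≡⟨ cong sumₗ (map-++ G (h x) (concatMap h xs)) ⟩
  sumₗ (map G (h x) ++ map G (concatMap h xs))
    ≡⟨ sum-++ (map G (h x)) (map G (concatMap h xs)) ⟩
  sumₗ (map G (h x)) + sumₗ (map G (concatMap h xs))
    ≡⟨ cong (sumₗ (map G (h x)) +_) (sum-concatMap G h xs) ⟩
  sumₗ (map G (h x)) + sumₗ (map (λ x → sumₗ (map G (h x))) xs) ∎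

sum-tabulate : (G : A → ℕ) (f : Fin n → A) → sumₗ (map G (tabulate f)) ≡ sum (G ∘ f)
sum-tabulate {n = zero}  G f = refl
sum-tabulate {n = suc n} G f = cong (G (f zero) +_) (sum-tabulate G (f ∘ suc))

sum-allVecs : ∀ b m (G : Vec (Fin b) m → ℕ) → sumₗ (map G (allVecs b m)) ≡ Σvecs b m G
sum-allVecs b zero    G = +-identityʳ (G []ᵥ)
sum-allVecs b (suc m) G = begin
  sumₗ (map G (allVecs b (suc m)))
    ≡⟨ sum-concatMap G (λ x → map (x ∷ᵥ_) (allVecs b m)) (allFin b) ⟩
  sumₗ (map (λ x → sumₗ (map G (map (x ∷ᵥ_) (allVecs b m)))) (allFin b))
    ≡⟨ sum-tabulate (λ x → sumₗ (map G (map (x ∷ᵥ_) (allVecs b m)))) id ⟩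
  sum (λ x → sumₗ (map G (map (x ∷ᵥ_) (allVecs b m))))
    ≡⟨ sum-cong-≗ (λ x → trans (cong sumₗ (sym (map-∘ (allVecs b m))))
         (sum-allVecs b m λ S → G (x ∷ᵥ S))) ⟩
  Σvecs b (suc m) G ∎

sum-allCards : ∀ b m {F : Endo b → ℕ} → Extensional F →
  sumₗ (map (F ∘ πCard) (allCards b m)) ≡ Σcards b m F
sum-allCards b m {F} ext = begin
  sumₗ (map (F ∘ πCard) (allCards b m))
    ≡⟨ sum-filter distinct? (F ∘ πCard) (allVecs b m) ⟩
  sumₗ (map (λ S → if does (distinct? S) then F (πCard S) else 0) (allVecs b m))
    ≡⟨ sum-allVecs b m _ ⟩
  Σvecs b m (λ S → if does (distinct? S) then F (πCard S) else 0)
    ≡⟨ Σdistinct b m F ext (F ∘ πCard) (λ S _ → refl) ⟩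
  Σcards b m F ∎

-- Sequences of cards as powers of B_m.

Σseqs : ∀ (m n : ℕ) → (Endo b → ℕ) → Endo b → ℕ
Σseqs {b} m n F τ = sumₗ (map (λ A → F (πSeq A ∘ τ)) (sampleSpace b m n))

Σseqs-ext : ∀ m n {F : Endo b → ℕ} → Extensional F → Extensional (Σseqs m n F)
Σseqs-ext {b} m n ext eq =
  cong sumₗ (map-cong (λ A → ext λ j → cong (πSeq A) (eq j)) (sampleSpace b m n))

-- The head of a sequence acts first, next to `τ`: B_m^(n+1) τ = B_m^n (B_m τ).
Σseqs-suc : ∀ m n {F : Endo b → ℕ} → Extensional F → ∀ τ →
  Σseqs m (suc n) F τ ≡ precompose m (Σseqs m n F) τ
Σseqs-suc {b} m n {F} ext τ = begin
  Σseqs m (suc n) F τ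
    ≡⟨ sum-concatMap (λ A → F (πSeq A ∘ τ)) (λ C → map (C ∷_) (sampleSpace b m n)) (allCards b m) ⟩
  sumₗ (map (λ C → sumₗ (map (λ A → F (πSeq A ∘ τ)) (map (C ∷_) (sampleSpace b m n)))) (allCards b m))
    ≡⟨ cong sumₗ (map-cong (λ C → cong sumₗ (sym (map-∘ (sampleSpace b m n)))) (allCards b m)) ⟩
  sumₗ (map (λ C → Σseqs m n F (πCard C ∘ τ)) (allCards b m))
    ≡⟨ sum-allCards b m (λ eq → Σseqs-ext m n ext (eq ∘ τ)) ⟩
  precompose m (Σseqs m n F) τ ∎

Σseqs-balanced : ∀ m n {F G : Endo b → ℕ} → Extensional F → Extensional G →
  Balanced F G → Balanced (Σseqs m n F) (Σseqs m n G)
Σseqs-balanced {b} m zero {F} {G} extF extG bal k = begin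
  Σcards b (suc k) (λ τ → F τ + 0)  ≡⟨ Σcards-cong b (suc k) (λ τ → +-identityʳ (F τ)) ⟩
  Σcards b (suc k) F                ≡⟨ bal k ⟩
  Σcards b (suc k) G                ≡⟨ Σcards-cong b (suc k) (λ τ → +-identityʳ (G τ)) ⟨
  Σcards b (suc k) (λ τ → G τ + 0)  ∎
Σseqs-balanced {b} m (suc n) {F} {G} extF extG bal k = begin
  Σcards b (suc k) (Σseqs m (suc n) F)
    ≡⟨ Σcards-cong b (suc k) (Σseqs-suc m n extF) ⟩
  Σcards b (suc k) (precompose m (Σseqs m n F))
    ≡⟨ precompose-balanced m (Σseqs-ext m n extF) (Σseqs-ext m n extG)
         (Σseqs-balanced m n extF extG bal) k ⟩
  Σcards b (suc k) (precompose m (Σseqs m n G))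
    ≡⟨ Σcards-cong b (suc k) (Σseqs-suc m n extG) ⟨
  Σcards b (suc k) (Σseqs m (suc n) G) ∎

length≡sum : (xs : List A) → length xs ≡ sumₗ (map (λ _ → 1) xs)
length≡sum []       = refl
length≡sum (x ∷ xs) = cong suc (length≡sum xs)

*-sumₗ : ∀ c (G : A → ℕ) (xs : List A) → c * sumₗ (map G xs) ≡ sumₗ (map (λ x → c * G x) xs)
*-sumₗ c G []       = *-zeroʳ c
*-sumₗ c G (x ∷ xs) = trans (*-distribˡ-+ c (G x) (sumₗ (map G xs))) (cong (c * G x +_) (*-sumₗ c G xs))

theorem6p4 : (b m n : ℕ) → 1 ≤ m → m ≤ b → 1 ≤ n →
    b * length (favourable b m n) ≡ length (sampleSpace b m n)
theorem6p4 b (suc m) (suc n) _ _ _ = begin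
  b * length (favourable b (suc m) (suc n))
    ≡⟨ cong (b *_) (trans (length≡sum (favourable b (suc m) (suc n)))
         (sum-filter (λ A → isFullCycle? (πSeq A)) (λ _ → 1) (sampleSpace b (suc m) (suc n)))) ⟩
  b * sumₗ (map (λ A → cycleIndicator (πSeq A)) (sampleSpace b (suc m) (suc n)))
    ≡⟨ *-sumₗ b (λ A → cycleIndicator (πSeq A)) (sampleSpace b (suc m) (suc n)) ⟩
  Σseqs (suc m) (suc n) F id
    -- `Balanced` speaks of B_k with k >= 1, whereas `id` is B_0. Splitting off the first card
    -- replaces `id` by B_k with k = `suc m`.
    ≡⟨ Σseqs-suc (suc m) n F-ext id ⟩
  Σcards b (suc m) (Σseqs (suc m) n F)
    ≡⟨ Σseqs-balanced (suc m) n F-ext 𝟙-ext (cycleIndicator-balanced b) m ⟩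
  Σcards b (suc m) (Σseqs (suc m) n 𝟙)
    ≡⟨ Σseqs-suc (suc m) n 𝟙-ext id ⟨
  Σseqs (suc m) (suc n) 𝟙 id
    ≡⟨ length≡sum (sampleSpace b (suc m) (suc n)) ⟨
  length (sampleSpace b (suc m) (suc n)) ∎
  where
  F : Endo b → ℕ
  F f = b * cycleIndicator f
  F-ext : Extensional F
  F-ext eq = cong (b *_) (cycleIndicator-ext eq)
  𝟙 : Endo b → ℕ
  𝟙 _ = 1
  𝟙-ext : Extensional 𝟙
  𝟙-ext _ = refl
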